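{- For every positive integer $k$ there is a constant $\gamma_k$ such that every strongly connected digraph $D$ with $\chi(D)>\gamma_k$ contains a subdivision of $B(k,1;k)$.
   Context: Digraphs are finite, without loops or parallel arcs (opposite arcs allowed). $\chi(D)$ is the chromatic number of the underlying undirected graph of $D$. A digraph is strongly connected if every vertex can reach every other vertex by a directed path. For positive integers $k_1,k_2,k_3$, a digraph $D$ contains a subdivision of $B(k_1,k_2;k_3)$ if there exist distinct vertices $x,y$ of $D$ and three pairwise internally vertex-disjoint directed paths in $D$: two from $x$ to $y$, of lengths (numbers of arcs) at least $k_1$ and at least $k_2$ respectively, and one from $y$ to $x$ of length at least $k_3$. -}

module Defs where

open import Data.Bool using (Bool; T)
open import Data.Fin using (Fin)
open import Data.List using (List; []; _∷_)
open import Data.List.Membership.Propositional using (_∈_)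
open import Data.List.Relation.Unary.Unique.Propositional using (Unique)
open import Data.Nat using (ℕ; zero; suc; _≤_)
open import Data.Product using (Σ-syntax; _×_)
open import Data.Sum using (_⊎_)
open import Relation.Binary.Construct.Closure.ReflexiveTransitive using (Star; ε; _◅_)
open import Relation.Binary.PropositionalEquality using (_≢_)
open import Relation.Nullary using (¬_)

-- A Boolean adjacency matrix allows at most one arc for each ordered pair
-- (so no parallel arcs), while opposite arcs remain possible.
record Digraph : Set where
  field
    order    : ℕ
    arc      : Fin order → Fin order → Bool
    loopless : ∀ v → ¬ T (arc v v)

  Vertex : Set
  Vertex = Fin order

  infix 4 _⟶_ _~_

  _⟶_ : Vertex → Vertex → Set
  u ⟶ v = T (arc u v)

  -- Adjacency in the underlying undirected graph.
  _~_ : Vertex → Vertex → Set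
  u ~ v = (u ⟶ v) ⊎ (v ⟶ u)

  Walk : Vertex → Vertex → Set
  Walk = Star _⟶_

  length : ∀ {u v} → Walk u v → ℕ
  length ε       = zero
  length (_ ◅ w) = suc (length w)

  vertices : ∀ {u v} → Walk u v → List Vertex
  vertices {u} ε       = u ∷ []
  vertices {u} (_ ◅ w) = u ∷ vertices w

  record Path (u v : Vertex) : Set where
    constructor mkPath
    field
      walk   : Walk u v
      simple : Unique (vertices walk)

open Digraph public using (Vertex; Path)

module _ (D : Digraph) where
  open Digraph D using (_~_; length; vertices)
  open Path using (walk)

  pathLength : ∀ {u v} → Path D u v → ℕ
  pathLength P = length (walk P)

  pathVertices : ∀ {u v} → Path D u v → List (Vertex D)
  pathVertices P = vertices (walk P)

  StronglyConnected : Set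
  StronglyConnected = ∀ u v → Path D u v

  Colourable : ℕ → Set
  Colourable c = Σ[ f ∈ (Vertex D → Fin c) ] (∀ u v → u ~ v → f u ≢ f v)

  -- χ(D) = c.
  IsChromaticNumber : ℕ → Set
  IsChromaticNumber c = Colourable c × (∀ c′ → Colourable c′ → c ≤ c′)

  Internal : ∀ {u v} → Vertex D → Path D u v → Set
  Internal {u} {v} w P = w ∈ pathVertices P × w ≢ u × w ≢ v

  InternallyDisjoint : ∀ {u v u′ v′} → Path D u v → Path D u′ v′ → Set
  InternallyDisjoint P Q = ∀ w → Internal w P → ¬ Internal w Q

  -- The two paths from x to y must be required to differ: internal
  -- disjointness alone would let both be the single arc from x to y
  -- when k₁ = k₂ = 1.
  record SubdivisionB (k₁ k₂ k₃ : ℕ) : Set where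
    field
      x y         : Vertex D
      x≢y         : x ≢ y
      P₁ P₂       : Path D x y
      P₃          : Path D y x
      k₁≤P₁       : k₁ ≤ pathLength P₁
      k₂≤P₂       : k₂ ≤ pathLength P₂
      k₃≤P₃       : k₃ ≤ pathLength P₃
      P₁≢P₂       : pathVertices P₁ ≢ pathVertices P₂
      disjoint₁₂  : InternallyDisjoint P₁ P₂
      disjoint₁₃  : InternallyDisjoint P₁ P₃
      disjoint₂₃  : InternallyDisjoint P₂ P₃

{-# OPTIONS --safe #-}

-- Fix a root r and a spanning out-tree T whose total depth is maximal: an arc
-- u → v then increases the depth or leads back to an ancestor of u.  If v has two
-- long back arcs to depths that are congruent modulo k, one is a chord of the cycle
-- closed by the other, with both sides long.  Otherwise the long back arcs have at
-- most k targets per vertex and can be coloured greedily; pairing this colouring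
-- with depth modulo k, every monochromatic arc increases the depth.  The same holds
-- for an in-tree T′ to r.
--
-- Let A be the digraph of the arcs that are monochromatic for both trees.  If A has
-- no walk of length 2k, it has a colouring with 2k colours.  Otherwise take such a
-- walk from a to b with midpoint w; by monotonicity of the two depths it meets
-- neither T[r,a] before a nor T′[b,r] after b.  Let p be the last vertex of T[r,a]
-- on T′[b,r].  Then T[p,a], the walk and T′[b,p] form a cycle C.  Follow T′[p,r] and
-- T[r,w] from p to w, and let q be the last vertex on C before w.  The part from q
-- to w is an ear of C.  If q is off the walk, both sides of C are long.  If not, q is
-- a T-ancestor of w between a and w, and the ear itself is long because the depths
-- of q and w are congruent modulo k.

module Submission where

open import Defs
open import Data.Bool.Properties using (T?)
open import Data.Empty using (⊥; ⊥-elim)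
open import Data.Fin using (Fin; zero; suc; combine; fromℕ<; toℕ)
import Data.Fin.Properties as Fin
open import Data.List using (List; []; _∷_; _++_; [_]; length)
open import Data.List.Properties using (length-++; ++-assoc)
open import Data.List.Membership.Propositional using (_∈_; _∉_; lose)
open import Data.List.Membership.Propositional.Properties
  using (∈-++⁺ˡ; ∈-++⁺ʳ; ∈-++⁻)
open import Data.List.Relation.Binary.Disjoint.Propositional using (Disjoint)
open import Data.List.Relation.Binary.Subset.Propositional using (_⊆_)
open import Data.List.Relation.Unary.All as All using (All; []; _∷_)
open import Data.List.Relation.Unary.All.Properties using (¬Any⇒All¬)
open import Data.List.Relation.Unary.AllPairs using ([]; _∷_)
open import Data.List.Relation.Unary.Any as Any using (Any; here; there)
open import Data.List.Relation.Unary.Unique.Propositional using (Unique)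
open import Data.List.Relation.Unary.Unique.Propositional.Properties
  using () renaming (++⁺ to Unique-++⁺)
open import Data.Nat using (ℕ; zero; suc; _+_; _*_; _∸_; _≤_; _<_; z≤n; s≤s;
  _≤?_; _<?_; NonZero; >-nonZero)
open import Data.Nat.DivMod using (_%_; _/_; _mod_; m≡m%n+[m/n]*n; m%n<n)
open import Data.Nat.Divisibility using (divides; ∣⇒≤)
open import Data.Nat.Induction using (Acc; acc; <-wellFounded)
import Data.Nat.Properties as ℕ
open import Data.Product using (Σ-syntax; ∃-syntax; _×_; _,_; proj₁; proj₂)
open import Data.Sum using (_⊎_; inj₁; inj₂)
open import Data.Unit using (⊤; tt)
open import Function using (_∘_; flip)
open import Relation.Binary.Construct.Closure.ReflexiveTransitive
  using (Star; ε; _◅_; reverse)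
open import Relation.Binary.Definitions using (tri<; tri≈; tri>)
open import Relation.Binary.PropositionalEquality
  using (_≡_; _≢_; refl; sym; trans; cong; cong₂; subst; module ≡-Reasoning)
open import Relation.Nullary using (¬_; Dec; yes; no; contradiction)
open import Relation.Nullary.Decidable using (_×-dec_; ¬?)
open import Relation.Unary using (Decidable)

-- Walks carrying their vertex lists

-- The list holds every vertex of the walk except the last one, so that
-- concatenation of walks is concatenation of lists, the length of a walk is
-- the length of its list, and a closed walk is a cycle when its list is Unique.
data Seg {V : Set} (R : V → V → Set) : V → List V → V → Set where
  []  : ∀ {u} → Seg R u [] u
  _∷_ : ∀ {u w xs v} → R u w → Seg R w xs v → Seg R u (u ∷ xs) v

infixr 5 _++ˢ_

_++ˢ_ : ∀ {V : Set} {R : V → V → Set} {u xs v ys w} →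
        Seg R u xs v → Seg R v ys w → Seg R u (xs ++ ys) w
[]       ++ˢ t = t
(a ∷ s) ++ˢ t = a ∷ (s ++ˢ t)

mapˢ : ∀ {V : Set} {R S : V → V → Set} → (∀ {u v} → R u v → S u v) →
       ∀ {u xs v} → Seg R u xs v → Seg S u xs v
mapˢ f []      = []
mapˢ f (a ∷ s) = f a ∷ mapˢ f s

reverseˢ : ∀ {V : Set} {R : V → V → Set} {u xs v} → Seg R u xs v →
           ∃[ ys ] (Seg (flip R) v ys u × length ys ≡ length xs)
reverseˢ []                 = [] , [] , refl
reverseˢ {u = u} (_∷_ {w = w} {xs = xs} a s) with reverseˢ s
... | ys , t , eq = ys ++ [ w ] , t ++ˢ (a ∷ []) ,
  trans (length-++ ys) (trans (ℕ.+-comm _ 1) (cong suc eq))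

head∈ : ∀ {V : Set} {R : V → V → Set} {u xs v} → Seg R u xs v → u ≢ v → u ∈ xs
head∈ []      u≢u = contradiction refl u≢u
head∈ (_ ∷ _) _   = here refl

split∈ : ∀ {V : Set} {R : V → V → Set} {u xs v z} → Seg R u xs v → z ∈ xs →
         ∃[ ys ] ∃[ zs ] (xs ≡ ys ++ z ∷ zs × Seg R u ys z × Seg R z (z ∷ zs) v)
split∈ (a ∷ s) (here refl) = [] , _ , refl , [] , a ∷ s
split∈ (a ∷ s) (there z∈) with split∈ s z∈
... | ys , zs , refl , s₁ , s₂ = _ ∷ ys , zs , refl , a ∷ s₁ , s₂

splitEnd : ∀ {V : Set} {R : V → V → Set} {u xs v z} → Seg R u xs v → z ∈ xs ++ [ v ] →
           ∃[ ys ] ∃[ zs ] (xs ≡ ys ++ zs × Seg R u ys z × Seg R z zs v)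
splitEnd []      (here refl) = [] , [] , refl , [] , []
splitEnd (a ∷ s) (here refl) = [] , _ , refl , [] , a ∷ s
splitEnd (a ∷ s) (there z∈) with splitEnd s z∈
... | ys , zs , refl , s₁ , s₂ = _ ∷ ys , zs , refl , a ∷ s₁ , s₂

splitLength : ∀ {V : Set} {R : V → V → Set} m {n u xs v} → Seg R u xs v →
  length xs ≡ m + n →
  ∃[ w ] ∃[ ys ] ∃[ zs ] (Seg R u ys w × Seg R w zs v × length ys ≡ m × length zs ≡ n)
splitLength zero    s        eq = _ , [] , _ , [] , s , refl , eq
splitLength (suc m) []       ()
splitLength (suc m) (a ∷ s) eq with splitLength m s (ℕ.suc-injective eq)
... | w , ys , zs , s₁ , s₂ , p , q = w , _ , zs , a ∷ s₁ , s₂ , cong suc p , q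

-- Cuts a tree path at its last vertex on a given path or cycle, so that the remainder can be
-- attached without further meetings.
splitLast : ∀ {V : Set} {R : V → V → Set} {P : V → Set} → Decidable P →
  ∀ {u xs v} → Seg R u xs v → Any P xs →
  ∃[ q ] ∃[ ys ] ∃[ zs ] (xs ≡ ys ++ q ∷ zs × P q × All (¬_ ∘ P) zs ×
                          Seg R u ys q × Seg R q (q ∷ zs) v)
splitLast P? (_∷_ {xs = xs} a s) any with Any.any? P? xs
splitLast P? (a ∷ s) _ | yes p with splitLast P? s p
... | q , ys , zs , refl , Pq , ¬P , s₁ , s₂ = q , _ ∷ ys , zs , refl , Pq , ¬P , a ∷ s₁ , s₂
splitLast P? (a ∷ s) (here Pu) | no ¬p =
  _ , [] , _ , refl , Pu , ¬Any⇒All¬ _ ¬p , [] , a ∷ s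
splitLast P? (a ∷ s) (there p) | no ¬p = contradiction p ¬p

module _ {n : ℕ} where

  open import Data.List.Membership.DecPropositional (Fin._≟_ {n}) using (_∈?_)

  -- An ear assembled from two overlapping paths becomes simple; by `ys ⊆ xs` it acquires no new
  -- meeting with the cycle.
  eraseLoops : ∀ {R : Fin n → Fin n → Set} {u xs v} → Seg R u xs v →
               ∃[ ys ] (Seg R u ys v × Unique ys × ys ⊆ xs)
  eraseLoops []                = [] , [] , [] , λ ()
  eraseLoops {u = u} (a ∷ s) with eraseLoops s
  ... | ys , t , uniq , ys⊆ with u ∈? ys
  ... | no u∉ = u ∷ ys , a ∷ t , ¬Any⇒All¬ _ u∉ ∷ uniq ,
                λ { (here eq) → here eq ; (there z∈) → there (ys⊆ z∈) }
  ... | yes u∈ = suffix t u∈ uniq (there ∘ ys⊆)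
    where
    suffix : ∀ {R : Fin n → Fin n → Set} {w xs v z ws} → Seg R w xs v → z ∈ xs →
             Unique xs → xs ⊆ ws → ∃[ ys ] (Seg R z ys v × Unique ys × ys ⊆ ws)
    suffix (b ∷ t) (here refl) uniq       sub = _ , b ∷ t , uniq , sub
    suffix (b ∷ t) (there z∈) (_ ∷ uniq) sub = suffix t z∈ uniq (sub ∘ there)

module _ {V : Set} {R S : V → V → Set} (S-trans : ∀ {x y z} → S x y → S y z → S x z)
         (R⇒S : ∀ {x y} → R x y → S x y) where

  -- Later `S` compares depths, in either direction, or is congruence of depths modulo `k`.
  -- Congruence is reflexive, so irreflexivity is a premise of `≺⇒Unique` alone.
  ≺-first : ∀ {u xs v z} → Seg R u xs v → z ∈ xs → u ≡ z ⊎ S u z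
  ≺-first (_ ∷ _) (here refl) = inj₁ refl
  ≺-first (a ∷ s) (there z∈) with ≺-first s z∈
  ... | inj₁ refl = inj₂ (R⇒S a)
  ... | inj₂ wz   = inj₂ (S-trans (R⇒S a) wz)

  ends : ∀ {u xs v} → Seg R u xs v → u ≡ v ⊎ S u v
  ends []      = inj₁ refl
  ends (a ∷ s) with ends s
  ... | inj₁ refl = inj₂ (R⇒S a)
  ... | inj₂ wv   = inj₂ (S-trans (R⇒S a) wv)

  ≺-last : ∀ {u xs v z} → Seg R u xs v → z ∈ xs → S z v
  ≺-last (a ∷ s) (here refl) with ends s
  ... | inj₁ refl = R⇒S a
  ... | inj₂ wv   = S-trans (R⇒S a) wv
  ≺-last (_ ∷ s) (there z∈) = ≺-last s z∈

  ≺⇒Unique : (∀ {x} → ¬ S x x) → ∀ {u xs v} → Seg R u xs v → Unique xs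
  ≺⇒Unique irr []      = []
  ≺⇒Unique irr (a ∷ s) = All.tabulate distinct ∷ ≺⇒Unique irr s
    where
    distinct : ∀ {z} → z ∈ _ → _ ≢ z
    distinct z∈ refl with ≺-first s z∈
    ... | inj₁ refl = irr (R⇒S a)
    ... | inj₂ wz   = irr (S-trans (R⇒S a) wz)

-- Repetition-free concatenations

Unique-++ˡ : ∀ {A : Set} (xs : List A) {ys} → Unique (xs ++ ys) → Unique xs
Unique-++ˡ []       _          = []
Unique-++ˡ (x ∷ xs) (x∉ ∷ uniq) =
  All.tabulate (λ z∈ → All.lookup x∉ (∈-++⁺ˡ z∈)) ∷ Unique-++ˡ xs uniq

Unique-++ʳ : ∀ {A : Set} (xs : List A) {ys} → Unique (xs ++ ys) → Unique ys
Unique-++ʳ []       uniq       = uniq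
Unique-++ʳ (x ∷ xs) (_ ∷ uniq) = Unique-++ʳ xs uniq

Unique-++-disjoint : ∀ {A : Set} (xs : List A) {ys} → Unique (xs ++ ys) → Disjoint xs ys
Unique-++-disjoint (x ∷ xs) (x∉ ∷ _) (here refl , z∈ys) =
  All.lookup x∉ (∈-++⁺ʳ xs z∈ys) refl
Unique-++-disjoint (x ∷ xs) (_ ∷ uniq) (there z∈xs , z∈ys) =
  Unique-++-disjoint xs uniq (z∈xs , z∈ys)

∈-∷ʳ⁻ : ∀ {A : Set} {xs : List A} {y z} → z ∈ xs ++ [ y ] → z ≢ y → z ∈ xs
∈-∷ʳ⁻ {xs = xs} z∈ z≢y with ∈-++⁻ xs z∈
... | inj₁ z∈xs       = z∈xs
... | inj₂ (here z≡y) = contradiction z≡y z≢y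

-- Subdivisions from a cycle with an ear

module _ (D : Digraph) where
  open Digraph D using (_⟶_)

  toWalk : ∀ {u xs v} → Seg _⟶_ u xs v → Digraph.Walk D u v
  toWalk []      = ε
  toWalk (a ∷ s) = a ◅ toWalk s

  vertices-toWalk : ∀ {u xs v} (s : Seg _⟶_ u xs v) →
                    Digraph.vertices D (toWalk s) ≡ xs ++ [ v ]
  vertices-toWalk []      = refl
  vertices-toWalk (a ∷ s) = cong (_ ∷_) (vertices-toWalk s)

  length-toWalk : ∀ {u xs v} (s : Seg _⟶_ u xs v) →
                  Digraph.length D (toWalk s) ≡ length xs
  length-toWalk []      = refl
  length-toWalk (a ∷ s) = cong suc (length-toWalk s)

  toPath : ∀ {u xs v} → Seg _⟶_ u xs v → Unique xs → v ∉ xs → Path D u v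
  toPath s uniq v∉ = record
    { walk   = toWalk s
    ; simple = subst Unique (sym (vertices-toWalk s))
        (Unique-++⁺ uniq ([] ∷ []) λ { (z∈ , here refl) → v∉ z∈ })
    }

  private
    -- `bs` and `es` become the paths from `q` to `w`, the long one first, and `as` the return path.
    -- Lists omit the end of a walk, so `as` misses `q` while `bs` and `es` miss `w`.
    theta : ∀ {k w q as bs es} → 2 ≤ k → w ∈ as → q ∈ bs → q ∈ es →
      Seg _⟶_ w as q → Seg _⟶_ q bs w → Seg _⟶_ q es w →
      Unique as → Unique bs → Unique es → Disjoint as bs → Disjoint as es →
      (∀ {z} → z ∈ bs → z ∈ es → z ≡ q) →
      k ≤ length as → k ≤ length bs → SubdivisionB D k 1 k
    theta {k} {w} {q} {as} {bs} {es} 2≤k w∈as q∈bs q∈es sa sb se ua ub ue ab ae be k≤a k≤b =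
      record
      { x = q ; y = w
      ; x≢y = λ { refl → ab (w∈as , q∈bs) }
      ; P₁ = P₁ ; P₂ = P₂ ; P₃ = P₃
      ; k₁≤P₁ = subst (k ≤_) (sym (length-toWalk sb)) k≤b
      ; k₂≤P₂ = subst (1 ≤_) (sym (length-toWalk se)) (nonempty q∈es)
      ; k₃≤P₃ = subst (k ≤_) (sym (length-toWalk sa)) k≤a
      ; P₁≢P₂ = λ eq → distinct sb ub w∉bs (ℕ.≤-trans 2≤k k≤b) be
          (trans (sym (vertices-toWalk sb)) (trans eq (vertices-toWalk se)))
      ; disjoint₁₂ = λ z (z∈b , z≢q , z≢w) (z∈e , _ , _) →
          z≢q (be (inner sb z≢w z∈b) (inner se z≢w z∈e))
      ; disjoint₁₃ = λ z (z∈b , z≢q , z≢w) (z∈a , _ , _) →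
          ab (inner sa z≢q z∈a , inner sb z≢w z∈b)
      ; disjoint₂₃ = λ z (z∈e , z≢q , z≢w) (z∈a , _ , _) →
          ae (inner sa z≢q z∈a , inner se z≢w z∈e)
      }
      where
      w∉bs : w ∉ bs
      w∉bs w∈bs = ab (w∈as , w∈bs)

      P₁ P₂ : Path D q w
      P₁ = toPath sb ub w∉bs
      P₂ = toPath se ue (λ w∈es → ae (w∈as , w∈es))

      P₃ : Path D w q
      P₃ = toPath sa ua (λ q∈as → ab (q∈as , q∈bs))

      inner : ∀ {u xs v z} (s : Seg _⟶_ u xs v) → z ≢ v →
              z ∈ Digraph.vertices D (toWalk s) → z ∈ xs
      inner s z≢v z∈ = ∈-∷ʳ⁻ (subst (_ ∈_) (vertices-toWalk s) z∈) z≢v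

      nonempty : ∀ {z : Vertex D} {xs} → z ∈ xs → 1 ≤ length xs
      nonempty (here _)  = s≤s z≤n
      nonempty (there _) = s≤s z≤n

      distinct : ∀ {bs} → Seg _⟶_ q bs w → Unique bs → w ∉ bs → 2 ≤ length bs →
        (∀ {z} → z ∈ bs → z ∈ es → z ≡ q) → bs ++ [ w ] ≢ es ++ [ w ]
      distinct []               _        _  ()        _  _
      distinct (_ ∷ [])         _        _  (s≤s ())  _  _
      -- The second vertex of `bs` is neither `q` nor `w`; if the two vertex lists agreed, it would
      -- also lie on `es`, against `be`.
      distinct (_ ∷ (_∷_ {u = z} _ _)) ((q≢z ∷ _) ∷ _) w∉ _ be eq =
        q≢z (sym (be (there (here refl))
          (∈-∷ʳ⁻ (subst (z ∈_) eq (there (here refl)))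
                 (λ { refl → w∉ (there (here refl)) }))))

  -- Either path from `q` to `w` may be the long one: the two cases exchange `bs` and `es` in
  -- `theta`. Since `es` omits `w`, its only vertex on the cycle is `q`.
  cycleWithEar : ∀ {k w q as bs es} → 2 ≤ k → q ≢ w →
    Seg _⟶_ w as q → Seg _⟶_ q bs w → Unique (as ++ bs) →
    Seg _⟶_ q es w → Unique es → (∀ {z} → z ∈ es → z ∈ as ++ bs → z ≡ q) →
    k ≤ length as → k ≤ length bs ⊎ k ≤ length es → SubdivisionB D k 1 k
  cycleWithEar {w = w} {q} {as} {bs} {es} 2≤k q≢w sa sb uniq se ue ear k≤a = λ
    { (inj₁ k≤b) → theta 2≤k w∈as q∈bs q∈es sa sb se ua ub ue ab ae be k≤a k≤b
    ; (inj₂ k≤e) → theta 2≤k w∈as q∈es q∈bs sa se sb ua ue ub ae ab (flip be) k≤a k≤e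
    }
    where
    w∈as : w ∈ as
    w∈as = head∈ sa (q≢w ∘ sym)
    q∈bs : q ∈ bs
    q∈bs = head∈ sb q≢w
    q∈es : q ∈ es
    q∈es = head∈ se q≢w
    ua : Unique as
    ua = Unique-++ˡ as uniq
    ub : Unique bs
    ub = Unique-++ʳ as uniq
    ab : Disjoint as bs
    ab = Unique-++-disjoint as uniq
    ae : Disjoint as es
    ae (z∈a , z∈e) with ear z∈e (∈-++⁺ˡ z∈a)
    ... | refl = ab (z∈a , q∈bs)
    be : ∀ {z} → z ∈ bs → z ∈ es → z ≡ q
    be z∈b z∈e = ear z∈e (∈-++⁺ʳ as z∈b)

-- Extremal indices, sums and residues

least : {P : ℕ → Set} → Decidable P → ∀ n → P n → ∃[ m ] (P m × (∀ {i} → P i → m ≤ i))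
least {P} P? n Pn = go n Pn (<-wellFounded n)
  where
  go : ∀ n → P n → Acc _<_ n → ∃[ m ] (P m × (∀ {i} → P i → m ≤ i))
  go n Pn (acc rs) with ℕ.anyUpTo? P? n
  ... | yes (i , i<n , Pi) = go i Pi (rs i<n)
  ... | no ¬smaller = n , Pn , λ Pi → ℕ.≮⇒≥ λ i<n → ¬smaller (_ , i<n , Pi)

lastTrue : {P : ℕ → Set} → Decidable P → P 0 → ∀ n → ¬ P n →
           ∃[ i ] (i < n × P i × ¬ P (suc i))
lastTrue P? P0 zero    ¬P0 = contradiction P0 ¬P0
lastTrue P? P0 (suc n) ¬Pn with P? n
... | yes Pn  = n , ℕ.≤-refl , Pn , ¬Pn
... | no  ¬Pn′ with lastTrue P? P0 n ¬Pn′
... | i , i<n , Pi , ¬Psi = i , ℕ.m≤n⇒m≤1+n i<n , Pi , ¬Psi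

total : ∀ {n} → (Fin n → ℕ) → ℕ
total {zero}  f = 0
total {suc n} f = f zero + total (f ∘ suc)

≤total : ∀ {n} (f : Fin n → ℕ) i → f i ≤ total f
≤total f zero    = ℕ.m≤m+n _ _
≤total f (suc i) = ℕ.≤-trans (≤total (f ∘ suc) i) (ℕ.m≤n+m _ _)

total-mono : ∀ {n} (f g : Fin n → ℕ) → (∀ i → f i ≤ g i) → total f ≤ total g
total-mono {zero}  f g f≤g = z≤n
total-mono {suc n} f g f≤g = ℕ.+-mono-≤ (f≤g zero) (total-mono _ _ (f≤g ∘ suc))

total-mono-< : ∀ {n} (f g : Fin n → ℕ) → (∀ i → f i ≤ g i) →
               ∀ i → f i < g i → total f < total g
total-mono-< f g f≤g zero    lt = ℕ.+-mono-<-≤ lt (total-mono _ _ (f≤g ∘ suc))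
total-mono-< f g f≤g (suc i) lt = ℕ.+-mono-≤-< (f≤g zero) (total-mono-< _ _ (f≤g ∘ suc) i lt)

-- The difference is a positive multiple of `k`.
mod-gap : ∀ {k} .{{_ : NonZero k}} {a b} → a < b → a mod k ≡ b mod k → a + k ≤ b
mod-gap {k} {a} {b} a<b eq = subst (a + k ≤_) (ℕ.m+[n∸m]≡n (ℕ.<⇒≤ a<b))
  (ℕ.+-monoʳ-≤ a (∣⇒≤ {{>-nonZero (ℕ.m<n⇒0<n∸m a<b)}} (divides (b / k ∸ a / k) difference)))
  where
  open ≡-Reasoning
  rem : a % k ≡ b % k
  rem = trans (sym (Fin.toℕ-fromℕ< (m%n<n a k)))
              (trans (cong toℕ eq) (Fin.toℕ-fromℕ< (m%n<n b k)))
  difference : b ∸ a ≡ (b / k ∸ a / k) * k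
  difference = begin
    b ∸ a
      ≡⟨ cong₂ _∸_ (m≡m%n+[m/n]*n b k) (m≡m%n+[m/n]*n a k) ⟩
    (b % k + b / k * k) ∸ (a % k + a / k * k)
      ≡⟨ cong (λ r → (b % k + b / k * k) ∸ (r + a / k * k)) rem ⟩
    (b % k + b / k * k) ∸ (b % k + a / k * k)
      ≡⟨ ℕ.[m+n]∸[m+o]≡n∸o (b % k) _ _ ⟩
    b / k * k ∸ a / k * k
      ≡⟨ ℕ.*-distribʳ-∸ k (b / k) (a / k) ⟨
    (b / k ∸ a / k) * k ∎

-- Colourings by walk length and by greedy choice

module _ {n : ℕ} {R : Fin n → Fin n → Set} (R? : ∀ u v → Dec (R u v)) where

  -- Used with all vertices as sources for the colouring by walk length, and with the root alone for
  -- breadth-first distances.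
  Reach : (Fin n → Set) → ℕ → Fin n → Set
  Reach S zero    v = S v
  Reach S (suc m) v = ∃[ u ] (Reach S m u × R u v)

  reach? : ∀ {S} → Decidable S → ∀ m → Decidable (Reach S m)
  reach? S? zero    v = S? v
  reach? S? (suc m) v = Fin.any? λ u → reach? S? m u ×-dec R? u v

  Reach⇒Seg : ∀ {S} m {v} → Reach S m v →
              ∃[ u ] ∃[ xs ] (Seg R u xs v × length xs ≡ m)
  Reach⇒Seg zero    _           = _ , [] , [] , refl
  Reach⇒Seg (suc m) (w , r , a) with Reach⇒Seg m r
  ... | u , xs , s , eq = u , xs ++ [ w ] , s ++ˢ (a ∷ []) ,
    trans (length-++ xs) (trans (ℕ.+-comm _ 1) (cong suc eq))

  Star⇒Reach : ∀ {S u v} m → Reach S m u → Star R u v → ∃[ l ] Reach S l v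
  Star⇒Reach m r ε       = m , r
  Star⇒Reach m r (a ◅ s) = Star⇒Reach (suc m) (_ , r , a) s

  -- Colour `v` with some `i < N` such that a walk of length `i` ends at `v` but none of length
  -- `i + 1` does. An arc from `u` to `v` extends the walk that witnesses the colour of `u`, so the
  -- colours differ.
  longWalkOrColouring : ∀ N →
    (∃[ u ] ∃[ v ] ∃[ xs ] (Seg R u xs v × length xs ≡ N)) ⊎
    (Σ[ f ∈ (Fin n → Fin N) ] (∀ {u v} → R u v → f u ≢ f v))
  longWalkOrColouring N with Fin.any? (reach? {λ _ → ⊤} (λ _ → yes tt) N)
  ... | yes (v , r) with Reach⇒Seg N r
  ...   | u , xs , s , eq = inj₁ (u , v , xs , s , eq)
  longWalkOrColouring N | no ¬long = inj₂ (f , proper)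
    where
    level : ∀ v → ∃[ i ] (i < N × Reach (λ _ → ⊤) i v × ¬ Reach (λ _ → ⊤) (suc i) v)
    level v = lastTrue (λ i → reach? (λ _ → yes tt) i v) tt N (λ r → ¬long (v , r))

    f : Fin n → Fin N
    f v = fromℕ< (proj₁ (proj₂ (level v)))

    proper : ∀ {u v} → R u v → f u ≢ f v
    proper {u} {v} a eq =
      let i , i<N , ri , _ = level u
          j , j<N , _ , ¬rj = level v
          i≡j : i ≡ j
          i≡j = trans (sym (Fin.toℕ-fromℕ< i<N)) (trans (cong toℕ eq) (Fin.toℕ-fromℕ< j<N))
      in ¬rj (subst (λ j → Reach _ (suc j) v) i≡j (u , ri , a))

-- The targets of `v` under `Q` have distinct labels, so there are at most `k` of them and one of
-- `k + 1` colours is free. Colouring in order of `rank` treats all targets of `v` before `v`.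
greedyColouring : ∀ {n k} {Q : Fin n → Fin n → Set} → (∀ v u → Dec (Q v u)) →
  (rank : Fin n → ℕ) → (∀ {v u} → Q v u → rank u < rank v) →
  (label : Fin n → Fin k) →
  (∀ {v u u′} → Q v u → Q v u′ → label u ≡ label u′ → u ≡ u′) →
  Σ[ f ∈ (Fin n → Fin (suc k)) ] (∀ {v u} → Q v u → f v ≢ f u)
greedyColouring {n} {k} {Q} Q? rank down label inj =
  let f , proper = go (suc (total rank)) in f , proper (s≤s (≤total rank _))
  where
  free : (f : Fin n → Fin (suc k)) → ∀ v → ∃[ c ] (∀ {u} → Q v u → c ≢ f u)
  free f v with Fin.any? (λ c → ¬? (Fin.any? (λ u → Q? v u ×-dec (c Fin.≟ f u))))
  ... | yes (c , unused) = c , λ q eq → unused (_ , q , eq)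
  ... | no ¬free = ⊥-elim clash
    where
    user : ∀ c → ∃[ u ] (Q v u × c ≡ f u)
    user c with Fin.any? (λ u → Q? v u ×-dec (c Fin.≟ f u))
    ... | yes used = used
    ... | no unused = contradiction (c , unused) ¬free
    clash : ⊥
    -- If every colour were taken, two of the `k + 1` users would share a label, hence coincide, and
    -- yet have different colours.
    clash with Fin.pigeonhole ℕ.≤-refl (label ∘ proj₁ ∘ user)
    ... | c , c′ , c<c′ , eq =
      let u , q , c≡ = user c
          u′ , q′ , c′≡ = user c′
      in Fin.<⇒≢ c<c′ (trans c≡ (trans (cong f (inj q q′ eq)) (sym c′≡)))

  go : ∀ m → Σ[ f ∈ (Fin n → Fin (suc k)) ] (∀ {v u} → rank v < m → Q v u → f v ≢ f u)
  go zero    = (λ _ → zero) , λ ()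
  go (suc m) with go m
  ... | f , proper = g , g-proper
    where
    g : Fin n → Fin (suc k)
    g v with rank v <? m
    ... | yes _ = f v
    ... | no  _ = proj₁ (free f v)

    g-proper : ∀ {v u} → rank v < suc m → Q v u → g v ≢ g u
    g-proper {v} {u} (s≤s v≤m) q with rank v <? m | rank u <? m
    ... | yes v<m | yes _   = proper v<m q
    ... | yes v<m | no  u≮m = contradiction (ℕ.<-trans (down q) v<m) u≮m
    ... | no  _   | yes _   = proj₂ (free f v) q
    ... | no  _   | no  u≮m = contradiction (ℕ.<-≤-trans (down q) v≤m) u≮m

-- Deepened spanning trees

-- The field final says that no vertex gets deeper by being rehung below an in-neighbour.
record OutTree {n : ℕ} (R : Fin n → Fin n → Set) (r : Fin n) : Set where
  field
    depth  : Fin n → ℕ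
    branch : Fin n → List (Fin n)

  TreeArc : Fin n → Fin n → Set
  TreeArc u v = R u v × depth v ≡ suc (depth u)

  field
    stem  : ∀ v → Seg TreeArc r (branch v) v
    final : ∀ {u v} → R u v → depth u < depth v ⊎ v ∈ branch u

  deeper : ∀ {u v} → TreeArc u v → depth u < depth v
  deeper (_ , eq) = ℕ.≤-reflexive (sym eq)

  tree-first : ∀ {u xs v z} → Seg TreeArc u xs v → z ∈ xs → u ≡ z ⊎ depth u < depth z
  tree-first = ≺-first {S = λ x y → depth x < depth y} ℕ.<-trans deeper

  tree-last : ∀ {u xs v z} → Seg TreeArc u xs v → z ∈ xs → depth z < depth v
  tree-last = ≺-last {S = λ x y → depth x < depth y} ℕ.<-trans deeper

  tree-unique : ∀ {u xs v} → Seg TreeArc u xs v → Unique xs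
  tree-unique = ≺⇒Unique {S = λ x y → depth x < depth y} ℕ.<-trans deeper (ℕ.<-irrefl refl)

  stem-length : ∀ {u xs v} → Seg TreeArc u xs v → depth v ≡ length xs + depth u
  stem-length []            = refl
  stem-length {xs = _ ∷ xs} ((_ , eq) ∷ s) = trans (stem-length s)
    (trans (cong (length xs +_) eq) (ℕ.+-suc (length xs) _))

module _ {n : ℕ} {R : Fin n → Fin n → Set} (R? : ∀ u v → Dec (R u v))
         (R-irrefl : ∀ {u} → ¬ R u u) (r : Fin n) where

  -- With parent pointers, rehanging changes one pointer and shifts the depths of one subtree. The
  -- value `parent r` is arbitrary.
  record SpanningTree : Set where
    field
      depth  : Fin n → ℕ
      parent : Fin n → Fin n
      arc    : ∀ {v} → v ≢ r → R (parent v) v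
      step   : ∀ {v} → v ≢ r → depth v ≡ suc (depth (parent v))

    data Anc (u : Fin n) : Fin n → Set where
      here : Anc u u
      up   : ∀ {v} → v ≢ r → Anc u (parent v) → Anc u v

    private
      onDepth : {P : Fin n → Set} → P r → (∀ {v} → v ≢ r → P (parent v) → P v) → ∀ v → P v
      onDepth {P} Pr Pstep v = go v (<-wellFounded (depth v))
        where
        go : ∀ v → Acc _<_ (depth v) → P v
        go v (acc rs) with v Fin.≟ r
        ... | yes refl = Pr
        ... | no v≢r = Pstep v≢r (go (parent v) (rs (ℕ.≤-reflexive (sym (step v≢r)))))

    anc? : ∀ u v → Dec (Anc u v)
    anc? u = onDepth atRoot atChild
      where
      atRoot : Dec (Anc u r)
      atRoot with u Fin.≟ r
      ... | yes refl = yes here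
      ... | no u≢r = no λ { here → u≢r refl ; (up r≢r _) → r≢r refl }
      atChild : ∀ {v} → v ≢ r → Dec (Anc u (parent v)) → Dec (Anc u v)
      atChild v≢r (yes a) = yes (up v≢r a)
      atChild {v} v≢r (no ¬a) with u Fin.≟ v
      ... | yes refl = yes here
      ... | no u≢v = no λ { here → u≢v refl ; (up _ a) → ¬a a }

    root-anc : ∀ v → Anc r v
    root-anc = onDepth here up

    ancestors : ∀ {u v} → Anc u v → List (Fin n)
    ancestors here                = []
    ancestors {v = v} (up _ a) = ancestors a ++ [ parent v ]

    Anc⇒Seg : ∀ {u v} (a : Anc u v) →
              Seg (λ x y → R x y × depth y ≡ suc (depth x)) u (ancestors a) v
    Anc⇒Seg here       = []
    Anc⇒Seg (up v≢r a) = Anc⇒Seg a ++ˢ ((arc v≢r , step v≢r) ∷ [])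

    Anc⇒∈ : ∀ {u v} (a : Anc r u) → Anc v u → v ≡ u ⊎ v ∈ ancestors a
    Anc⇒∈ a            here         = inj₁ refl
    Anc⇒∈ here         (up r≢r _)  = contradiction refl r≢r
    Anc⇒∈ (up _ a)     (up _ b) with Anc⇒∈ a b
    ... | inj₁ refl = inj₂ (∈-++⁺ʳ (ancestors a) (here refl))
    ... | inj₂ v∈   = inj₂ (∈-++⁺ˡ v∈)

    depth≤ : ∀ {u v} → Anc u v → depth u ≤ depth v
    depth≤ here       = ℕ.≤-refl
    depth≤ (up v≢r a) =
      ℕ.≤-trans (depth≤ a) (ℕ.≤-trans (ℕ.n≤1+n _) (ℕ.≤-reflexive (sym (step v≢r))))

    -- Going up from `v` passes through every depth down to 0; one vertex per depth gives an
    -- injection from `Fin (suc (depth v))`. This bound makes the deepening terminate.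
    depth<n : depth r ≡ 0 → ∀ v → depth v < n
    depth<n root v =
      Fin.injective⇒≤ {f = λ i → proj₁ (ofDepth v (toℕ i) (Fin.toℕ≤pred[n] i))} λ {i} {j} eq →
      Fin.toℕ-injective (trans (sym (proj₂ (ofDepth v (toℕ i) (Fin.toℕ≤pred[n] i))))
        (trans (cong depth eq) (proj₂ (ofDepth v (toℕ j) (Fin.toℕ≤pred[n] j)))))
      where
      ofDepth : ∀ v i → i ≤ depth v → ∃[ x ] depth x ≡ i
      ofDepth = onDepth (λ i i≤ → r , trans root (sym (ℕ.n≤0⇒n≡0 (subst (i ≤_) root i≤)))) below
        where
        below : ∀ {v} → v ≢ r → (∀ i → i ≤ depth (parent v) → ∃[ x ] depth x ≡ i) →
                ∀ i → i ≤ depth v → ∃[ x ] depth x ≡ i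
        below {v} v≢r rec i i≤ with ℕ.m≤n⇒m<n∨m≡n i≤
        ... | inj₂ eq = v , sym eq
        ... | inj₁ i< = rec i (ℕ.≤-pred (subst (i <_) (step v≢r) i<))

  private
    module _ (T : SpanningTree) where
      open SpanningTree T

      -- Hanging `v` below `u` shifts the old subtree of `v` by `δ`, which is positive. As `v` is no
      -- ancestor of `u`, the depth of `u` is unchanged.
      rehang : ∀ {u v} → R u v → ¬ Anc v u → depth v ≤ depth u →
        Σ[ T′ ∈ SpanningTree ]
          ((∀ x → depth x ≤ SpanningTree.depth T′ x) × depth v < SpanningTree.depth T′ v ×
           (depth r ≡ 0 → SpanningTree.depth T′ r ≡ 0))
      rehang {u} {v} a ¬anc v≤u =
        record { depth = depth′ ; parent = parent′ ; arc = arc′ ; step = step′ } ,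
        depth≤′ ,
        subst (depth v <_) (sym atv) (s≤s v≤u) ,
        λ root → trans (outside λ b → ¬anc (ends-at-root b)) root
        where
        δ : ℕ
        δ = suc (depth u) ∸ depth v

        depth′ : Fin n → ℕ
        depth′ x with anc? v x
        ... | yes _ = δ + depth x
        ... | no  _ = depth x

        parent′ : Fin n → Fin n
        parent′ x with x Fin.≟ v
        ... | yes _ = u
        ... | no  _ = parent x

        inside : ∀ {x} → Anc v x → depth′ x ≡ δ + depth x
        inside {x} b with anc? v x
        ... | yes _ = refl
        ... | no ¬b = contradiction b ¬b

        outside : ∀ {x} → ¬ Anc v x → depth′ x ≡ depth x
        outside {x} ¬b with anc? v x
        ... | yes b = contradiction b ¬b
        ... | no _  = refl

        -- Only the root is an ancestor of the root, and it is an ancestor of `u`; hence the root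
        -- stays outside the moved subtree.
        ends-at-root : Anc v r → Anc v u
        ends-at-root here       = root-anc u
        ends-at-root (up r≢r _) = contradiction refl r≢r

        atv : depth′ v ≡ suc (depth u)
        atv = trans (inside here) (ℕ.m∸n+n≡m (ℕ.m≤n⇒m≤1+n v≤u))

        depth≤′ : ∀ x → depth x ≤ depth′ x
        depth≤′ x with anc? v x
        ... | yes _ = ℕ.m≤n+m _ δ
        ... | no  _ = ℕ.≤-refl

        arc′ : ∀ {x} → x ≢ r → R (parent′ x) x
        arc′ {x} x≢r with x Fin.≟ v
        ... | yes refl = a
        ... | no  _    = arc x≢r

        step′ : ∀ {x} → x ≢ r → depth′ x ≡ suc (depth′ (parent′ x))
        step′ {x} x≢r with x Fin.≟ v
        ... | yes refl = trans atv (cong suc (sym (outside ¬anc)))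
        -- For `x ≢ v`, both `x` and its parent are in the moved subtree or neither is, so their
        -- depths shift equally.
        ... | no x≢v with anc? v (parent x)
        ...   | yes b = trans (inside (up x≢r b))
                          (trans (cong (δ +_) (step x≢r)) (ℕ.+-suc δ _))
        ...   | no ¬b = trans (outside λ { here → x≢v refl ; (up _ b) → ¬b b }) (step x≢r)

  private
    Tree₀ : Set
    Tree₀ = Σ[ T ∈ SpanningTree ] SpanningTree.depth T r ≡ 0

    deficit : SpanningTree → ℕ
    deficit T = total (λ v → n ∸ SpanningTree.depth T v)

    -- Every rehanging lowers `deficit`, strictly because depths stay below `n`. When none is
    -- possible, an arc that does not increase the depth must lead to an ancestor.
    deepen : ((T , _) : Tree₀) → Acc _<_ (deficit T) → OutTree R r
    deepen (T , root) (acc rs) with Fin.any? (λ u → Fin.any? (λ v →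
        R? u v ×-dec (¬? (SpanningTree.anc? T v u) ×-dec
                      (SpanningTree.depth T v ≤? SpanningTree.depth T u))))
    ... | yes (u , v , a , ¬anc , v≤u) =
      let T′ , grows , v< , root′ = rehang T a ¬anc v≤u
          open SpanningTree
      in deepen (T′ , root′ root)
           (rs (total-mono-< _ _ (λ x → ℕ.∸-monoʳ-≤ n (grows x)) v
             (ℕ.∸-monoʳ-< v< (ℕ.<⇒≤ (depth<n T′ (root′ root) v)))))
    ... | no ¬rehang = record
      { depth  = depth
      ; branch = λ v → ancestors (root-anc v)
      ; stem   = λ v → Anc⇒Seg (root-anc v)
      ; final  = final
      }
      where
      open SpanningTree T
      final : ∀ {u v} → R u v → depth u < depth v ⊎ v ∈ ancestors (root-anc u)
      final {u} {v} a with depth u <? depth v | anc? v u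
      ... | yes u<v | _ = inj₁ u<v
      ... | no u≮v | no ¬anc = contradiction (u , v , a , ¬anc , ℕ.≮⇒≥ u≮v) ¬rehang
      ... | no _ | yes anc with Anc⇒∈ (root-anc u) anc
      ...   | inj₁ refl = contradiction a R-irrefl
      ...   | inj₂ v∈   = inj₂ v∈

  -- The starting tree: depth is the distance from the root, and a parent is the penultimate vertex
  -- of a shortest walk.
  breadthFirst : (∀ v → Star R r v) → Σ[ T ∈ SpanningTree ] SpanningTree.depth T r ≡ 0
  breadthFirst connected =
    record { depth = dist ; parent = λ v → proj₁ (previous v)
           ; arc = λ {v} v≢r → proj₁ (proj₂ (previous v) v≢r)
           ; step = λ {v} v≢r → proj₂ (proj₂ (previous v) v≢r) } ,
    ℕ.n≤0⇒n≡0 (proj₂ (proj₂ (shortest r)) refl)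
    where
    AtDistance : ℕ → Fin n → Set
    AtDistance = Reach R? (_≡ r)

    shortest : ∀ v → ∃[ m ] (AtDistance m v × (∀ {i} → AtDistance i v → m ≤ i))
    shortest v =
      let m , reached = Star⇒Reach R? 0 refl (connected v)
      in least (λ i → reach? R? (Fin._≟ r) i v) m reached

    dist : Fin n → ℕ
    dist v = proj₁ (shortest v)

    previous : ∀ v → ∃[ u ] (v ≢ r → R u v × dist v ≡ suc (dist u))
    previous v with shortest v in eq
    -- Distance 0 means the root, for which `v` itself is a dummy parent.
    ... | zero  , v≡r , _ = v , λ v≢r → contradiction v≡r v≢r
    ... | suc m , (u , reached , a) , minimal = u , λ _ → a ,
      ℕ.≤-antisym (minimal (u , proj₁ (proj₂ (shortest u)) , a))
                  (s≤s (proj₂ (proj₂ (shortest u)) reached))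

  outTree : (∀ v → Star R r v) → OutTree R r
  outTree connected = let T = breadthFirst connected in deepen T (<-wellFounded _)

-- Long back arcs

-- The arc v → u₂ is a chord of the cycle that v → u₁ closes with Tr.
LongChord : ∀ {n} (R Tr : Fin n → Fin n → Set) → ℕ → Set
LongChord R Tr k = ∃[ v ] ∃[ u₁ ] ∃[ u₂ ] ∃[ xs ] ∃[ ys ]
  (R v u₁ × R v u₂ × Seg Tr u₁ xs u₂ × Seg Tr u₂ ys v × k ≤ length xs × k ≤ length ys)

module _ {n : ℕ} {R : Fin n → Fin n → Set} (R? : ∀ u v → Dec (R u v)) {r : Fin n}
         (T : OutTree R r) (k : ℕ) .{{_ : NonZero k}} where

  open OutTree T
  open import Data.List.Membership.DecPropositional (Fin._≟_ {n}) using (_∈?_)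

  private
    Back : Fin n → Fin n → Set
    Back v u = R v u × u ∈ branch v × depth u + k ≤ depth v

    back? : ∀ v u → Dec (Back v u)
    back? v u = R? v u ×-dec (u ∈? branch v ×-dec (depth u + k ≤? depth v))

    residue : Fin n → Fin k
    residue v = depth v mod k

    split : ∀ {u xs v z} → Seg TreeArc u xs v → z ∈ xs →
      ∃[ ys ] ∃[ zs ] (Seg TreeArc u ys z × Seg TreeArc z zs v ×
                       (∀ {x} → x ∈ xs → depth x < depth z → x ∈ ys))
    split s z∈ with split∈ s z∈
    ... | ys , zs , refl , s₁ , s₂ = ys , _ , s₁ , s₂ , above
      where
      above : ∀ {x} → x ∈ ys ++ _ → depth x < depth _ → x ∈ ys
      above x∈ x<z with ∈-++⁻ ys x∈
      ... | inj₁ x∈ys = x∈ys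
      ... | inj₂ x∈zs with tree-first s₂ x∈zs
      ...   | inj₁ refl = contradiction x<z (ℕ.<-irrefl refl)
      ...   | inj₂ z<x  = contradiction x<z (ℕ.<-asym z<x)

    length≥ : ∀ {u xs v} → Seg TreeArc u xs v → depth u + k ≤ depth v → k ≤ length xs
    length≥ {u} {xs} s le = ℕ.+-cancelˡ-≤ (depth u) k (length xs)
      (ℕ.≤-trans le (ℕ.≤-reflexive (trans (stem-length s) (ℕ.+-comm (length xs) (depth u)))))

    -- Both targets lie on the stem of `v`, with `u₁` above `u₂`. Equal residues make the tree path
    -- between them long, and `far₂` makes the one from `u₂` to `v` long.
    longChord : ∀ {v u₁ u₂} → Back v u₁ → Back v u₂ → depth u₁ < depth u₂ →
                residue u₁ ≡ residue u₂ → LongChord R TreeArc k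
    longChord {v} (a₁ , u₁∈ , far₁) (a₂ , u₂∈ , far₂) u₁<u₂ eq =
      let _ , ys , s₁ , t , above = split (stem v) u₂∈
          _ , xs , _ , s , _ = split s₁ (above u₁∈ u₁<u₂)
      in v , _ , _ , xs , ys , a₁ , a₂ , s , t , length≥ s (mod-gap u₁<u₂ eq) , length≥ t far₂

    sameDepth : ∀ {v u₁ u₂} → u₁ ∈ branch v → u₂ ∈ branch v → depth u₁ ≡ depth u₂ → u₁ ≡ u₂
    sameDepth {v} u₁∈ u₂∈ eq with split∈ (stem v) u₂∈
    ... | ys , zs , e , s₁ , s₂ with ∈-++⁻ ys (subst (_ ∈_) e u₁∈)
    ... | inj₁ u₁∈ys = contradiction
      (tree-last s₁ u₁∈ys) (ℕ.<-irrefl eq)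
    ... | inj₂ u₁∈zs with tree-first s₂ u₁∈zs
    ...   | inj₁ refl = refl
    ...   | inj₂ u₂<u₁ = contradiction u₂<u₁ (ℕ.<-irrefl (sym eq))

  -- Without a long chord, the long back arcs at a vertex have targets of distinct residues, so
  -- `residue` serves as the label for the greedy colouring. The colour pairs the residue with the
  -- greedy colour.
  longChordOrColouring : LongChord R TreeArc k ⊎
    (Σ[ c ∈ (Fin n → Fin (k * suc k)) ] (∀ {u v} → c u ≡ c v →
       depth u mod k ≡ depth v mod k × (R u v → depth u < depth v)))
  longChordOrColouring with Fin.any? (λ v → Fin.any? (λ u₁ → Fin.any? (λ u₂ →
      back? v u₁ ×-dec (back? v u₂ ×-dec
      ((depth u₁ <? depth u₂) ×-dec (residue u₁ Fin.≟ residue u₂))))))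
  ... | yes (v , u₁ , u₂ , b₁ , b₂ , u₁<u₂ , eq) = inj₁ (longChord b₁ b₂ u₁<u₂ eq)
  ... | no ¬chord = inj₂ ((λ v → combine (residue v) (f v)) , separates)
    where
    back-injective : ∀ {v u₁ u₂} → Back v u₁ → Back v u₂ → residue u₁ ≡ residue u₂ → u₁ ≡ u₂
    back-injective {v} {u₁} {u₂} b₁ b₂ eq with ℕ.<-cmp (depth u₁) (depth u₂)
    ... | tri< lt _ _ = contradiction (v , u₁ , u₂ , b₁ , b₂ , lt , eq) ¬chord
    ... | tri≈ _ e _ = sameDepth (proj₁ (proj₂ b₁)) (proj₁ (proj₂ b₂)) e
    ... | tri> _ _ gt = contradiction (v , u₂ , u₁ , b₂ , b₁ , gt , sym eq) ¬chord

    greedy : Σ[ f ∈ (Fin n → Fin (suc k)) ] (∀ {v u} → Back v u → f v ≢ f u)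
    greedy = greedyColouring back? depth
      (λ {v} {u} (_ , u∈ , _) → tree-last (stem v) u∈)
      residue back-injective

    f : Fin n → Fin (suc k)
    f = proj₁ greedy

    separates : ∀ {u v} → combine (residue u) (f u) ≡ combine (residue v) (f v) →
      residue u ≡ residue v × (R u v → depth u < depth v)
    separates {u} {v} eq with Fin.combine-injective (residue u) (f u) (residue v) (f v) eq
    ... | same , fu≡fv = same , increases
      where
      increases : R u v → depth u < depth v
      increases a with final a
      ... | inj₁ lt = lt
      -- An arc to an ancestor of the same residue is a long back arc, whose ends the greedy
      -- colouring separates.
      ... | inj₂ v∈ = contradiction fu≡fv (proj₂ greedy (a , v∈ , mod-gap
        (tree-last (stem u) v∈) (sym same)))

-- Subdivisions from long chords

module _ (D : Digraph) {r : Vertex D} {k : ℕ} (2≤k : 2 ≤ k) where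
  open Digraph D using (_⟶_)

  -- Here `q` is `v` and `w` is `u₂`: the ear is the arc from `v` to `u₂`, the other path goes
  -- through `u₁`, and the return path is the tree path from `u₂` to `v`.
  outChord⇒SubdivisionB : (T : OutTree _⟶_ r) →
    LongChord _⟶_ (OutTree.TreeArc T) k → SubdivisionB D k 1 k
  outChord⇒SubdivisionB T (v , u₁ , u₂ , xs , ys , a₁ , a₂ , s , t , k≤x , k≤y) =
    cycleWithEar D 2≤k (λ { refl → ℕ.<-irrefl refl u₂<v })
      (mapˢ proj₁ t) (a₁ ∷ mapˢ proj₁ s)
      (Unique-++⁺ (tree-unique t) (All.tabulate v∉xs ∷ tree-unique s) disjoint)
      (a₂ ∷ []) ([] ∷ []) (λ { (here refl) _ → refl })
      k≤y (inj₁ (ℕ.m≤n⇒m≤1+n k≤x))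
    where
    open OutTree T
    u₂<v : depth u₂ < depth v
    u₂<v = subst (depth u₂ <_) (sym (stem-length t))
      (ℕ.+-monoˡ-< (depth u₂) (ℕ.≤-trans (ℕ.≤-trans (s≤s z≤n) 2≤k) k≤y))
    v∉xs : ∀ {z} → z ∈ xs → v ≢ z
    v∉xs z∈ refl = ℕ.<-asym u₂<v (tree-last s z∈)
    disjoint : Disjoint ys (v ∷ xs)
    disjoint (z∈ys , here refl) = ℕ.<-irrefl refl (tree-last t z∈ys)
    disjoint (z∈ys , there z∈xs) with tree-first t z∈ys
    ... | inj₁ refl = ℕ.<-irrefl refl (tree-last s z∈xs)
    ... | inj₂ u₂<z = ℕ.<-asym u₂<z (tree-last s z∈xs)

  -- Arcs are reversed, so `q` is `u₂` and `w` is `v`. The cycle runs from `v` through `u₂` to `u₁`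
  -- with falling depth and closes by the arc from `u₁` to `v`; the ear is the arc from `u₂` to `v`.
  inChord⇒SubdivisionB : (T : OutTree (flip _⟶_) r) →
    LongChord (flip _⟶_) (OutTree.TreeArc T) k → SubdivisionB D k 1 k
  inChord⇒SubdivisionB T (v , u₁ , u₂ , xs , ys , a₁ , a₂ , s , t , k≤x , k≤y)
    with reverseˢ s | reverseˢ t
  ... | xs′ , s′ , ∣xs′∣ | ys′ , t′ , ∣ys′∣ =
    cycleWithEar D 2≤k (λ { refl → ℕ.<-irrefl refl u₂<v })
      (mapˢ proj₁ t′) (mapˢ proj₁ s′ ++ˢ (a₁ ∷ []))
      (subst Unique (++-assoc ys′ xs′ [ u₁ ])
        (Unique-++⁺ (≺⇒Unique {S = _≻_} ≻-trans deeper (ℕ.<-irrefl refl) (t′ ++ˢ s′)) ([] ∷ [])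
          λ { (z∈ , here refl) →
            ℕ.<-irrefl refl (≺-last {S = _≻_} ≻-trans deeper (t′ ++ˢ s′) z∈) }))
      (a₂ ∷ []) ([] ∷ []) (λ { (here refl) _ → refl })
      (subst (k ≤_) (sym ∣ys′∣) k≤y)
      (inj₁ (ℕ.≤-trans (subst (k ≤_) (sym ∣xs′∣) k≤x)
        (ℕ.≤-trans (ℕ.m≤m+n _ 1) (ℕ.≤-reflexive (sym (length-++ xs′))))))
    where
    open OutTree T
    _≻_ : Vertex D → Vertex D → Set
    x ≻ y = depth y < depth x
    ≻-trans : ∀ {x y z} → x ≻ y → y ≻ z → x ≻ z
    ≻-trans x≻y y≻z = ℕ.<-trans y≻z x≻y
    u₂<v : depth u₂ < depth v
    u₂<v = subst (depth u₂ <_) (sym (stem-length t))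
      (ℕ.+-monoˡ-< (depth u₂) (ℕ.≤-trans (ℕ.≤-trans (s≤s z≤n) 2≤k) k≤y))

-- Subdivisions from long climbs

module _ (D : Digraph) {r : Vertex D} {k : ℕ} .{{_ : NonZero k}} (2≤k : 2 ≤ k)
         (Out : OutTree (Digraph._⟶_ D) r) (In : OutTree (flip (Digraph._⟶_ D)) r) where
  open Digraph D using (_⟶_)
  open OutTree Out
  open OutTree In using () renaming
    (depth to depth′; TreeArc to TreeArc′; deeper to deeper′; stem to stem′)
  open import Data.List.Membership.DecPropositional (Fin._≟_ {Digraph.order D}) using (_∈?_)

  Climb : Vertex D → Vertex D → Set
  Climb u v = u ⟶ v × depth u < depth v × depth′ v < depth′ u × depth u mod k ≡ depth v mod k

  longClimb⇒SubdivisionB : ∀ {a b ω} → Seg Climb a ω b → length ω ≡ k + k → SubdivisionB D k 1 k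
  longClimb⇒SubdivisionB {a} {b} walk len with splitLength k walk len
  ... | w , ω₁ , ω₂ , W₁ , W₂ , ∣ω₁∣ , ∣ω₂∣ = conclusion
    where
    _≺_ _≻′_ _≈_ : Vertex D → Vertex D → Set
    x ≺ y = depth x < depth y
    x ≻′ y = depth′ y < depth′ x
    x ≈ y = depth x mod k ≡ depth y mod k

    ≻′-trans : ∀ {x y z} → x ≻′ y → y ≻′ z → x ≻′ z
    ≻′-trans x≻y y≻z = ℕ.<-trans y≻z x≻y

    weaken : ∀ {x y} → x ≡ y ⊎ x ≺ y → depth x ≤ depth y
    weaken (inj₁ refl) = ℕ.≤-refl
    weaken (inj₂ lt)   = ℕ.<⇒≤ lt

    weaken′ : ∀ {x y} → x ≡ y ⊎ x ≻′ y → depth′ y ≤ depth′ x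
    weaken′ (inj₁ refl) = ℕ.≤-refl
    weaken′ (inj₂ lt)   = ℕ.<⇒≤ lt

    up : ∀ {x y} → Climb x y → x ≺ y
    up (_ , lt , _) = lt

    down′ : ∀ {x y} → Climb x y → x ≻′ y
    down′ (_ , _ , lt , _) = lt

    a≤w : depth a ≤ depth w
    a≤w = weaken (ends {S = _≺_} ℕ.<-trans up W₁)

    b≤w : depth′ b ≤ depth′ w
    b≤w = weaken′ (ends {S = _≻′_} ≻′-trans down′ W₂)

    proper : ∀ {u xs v} → Seg Climb u xs v → length xs ≡ k → u ∈ xs
    proper []      eq = contradiction (subst (2 ≤_) (sym eq) 2≤k) λ ()
    proper (_ ∷ _) _  = here refl

    b<w : depth′ b < depth′ w
    b<w = ≺-last {S = _≻′_} ≻′-trans down′ W₂ (proper W₂ ∣ω₂∣)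

    b<a : depth′ b < depth′ a
    b<a = ℕ.≤-<-trans b≤w (≺-last {S = _≻′_} ≻′-trans down′ W₁ (proper W₁ ∣ω₁∣))

    ω₁-depth : ∀ {z} → z ∈ ω₁ → depth a ≤ depth z × depth z < depth w × depth′ b < depth′ z
    ω₁-depth z∈ = weaken (≺-first {S = _≺_} ℕ.<-trans up W₁ z∈) ,
                  ≺-last {S = _≺_} ℕ.<-trans up W₁ z∈ ,
                  ℕ.≤-<-trans b≤w (≺-last {S = _≻′_} ≻′-trans down′ W₁ z∈)

    ω₂-depth : ∀ {z} → z ∈ ω₂ → depth w ≤ depth z × depth′ b < depth′ z
    ω₂-depth z∈ = weaken (≺-first {S = _≺_} ℕ.<-trans up W₂ z∈) ,
                  ≺-last {S = _≻′_} ≻′-trans down′ W₂ z∈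

    return : ∃[ σ ] (Seg (flip TreeArc′) b σ r × length σ ≡ _)
    return = reverseˢ (stem′ b)

    σ : List (Vertex D)
    σ = proj₁ return

    σ-seg : Seg (flip TreeArc′) b σ r
    σ-seg = proj₁ (proj₂ return)

    σ-depth : ∀ {z} → z ∈ σ → depth′ z ≤ depth′ b
    σ-depth z∈ = weaken′ (≺-first {S = _≻′_} ≻′-trans deeper′ σ-seg z∈)

    r≤b : depth′ r ≤ depth′ b
    r≤b = weaken′ (ends {S = _≻′_} ≻′-trans deeper′ σ-seg)

    above-b : ∀ {z} → depth′ b < depth′ z → r ≢ z
    above-b b<z refl = ℕ.<⇒≱ b<z r≤b

    conclusion : SubdivisionB D k 1 k
    conclusion
      -- A common vertex exists: `σ` omits its end `r`, which is added back, and `branch a` contains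
      -- `r` because `a ≢ r`.
      with splitLast (_∈? (σ ++ [ r ])) (stem a)
             (lose (head∈ (stem a) (above-b b<a)) (∈-++⁺ʳ σ (here refl)))
    ... | p , _ , α , branch≡ , p∈σ , α∉σ , _ , α-seg with splitEnd σ-seg p∈σ
    ... | σ₁ , σ₂ , σ≡ , σ₁-seg , σ₂-seg = ear
      where
      μ : List (Vertex D)
      μ = σ₁ ++ p ∷ α

      μ-seg : Seg _⟶_ b μ a
      μ-seg = mapˢ proj₁ σ₁-seg ++ˢ mapˢ proj₁ α-seg

      -- Listed from `w` on, so that cutting at `q` gives the side from `w` to `q` and then the side
      -- from `q` to `w`.
      cycle : List (Vertex D)
      cycle = ω₂ ++ (μ ++ ω₁)

      σ₁⊆σ : ∀ {z} → z ∈ σ₁ → z ∈ σ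
      σ₁⊆σ z∈ = subst (_ ∈_) (sym σ≡) (∈-++⁺ˡ z∈)

      σ₂⊆σ : ∀ {z} → z ∈ σ₂ → z ∈ σ
      σ₂⊆σ z∈ = subst (_ ∈_) (sym σ≡) (∈-++⁺ʳ σ₁ z∈)

      α-depth : ∀ {z} → z ∈ p ∷ α → depth z < depth a
      α-depth = tree-last α-seg

      -- On `μ`, the in-tree part has `depth′` at most that of `b`, and the out-tree part has
      -- `depth` below that of `a`.
      off-climb : ∀ {z} → z ∈ μ → depth a ≤ depth z → depth′ b < depth′ z → ⊥
      off-climb z∈ a≤z b<z with ∈-++⁻ σ₁ z∈
      ... | inj₁ z∈σ = ℕ.<⇒≱ b<z (σ-depth (σ₁⊆σ z∈σ))
      ... | inj₂ z∈α = ℕ.<⇒≱ (α-depth z∈α) a≤z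

      cycle-unique : Unique cycle
      cycle-unique = Unique-++⁺ (≺⇒Unique {S = _≺_} ℕ.<-trans up (ℕ.<-irrefl refl) W₂)
        (Unique-++⁺
          (Unique-++⁺ (≺⇒Unique {S = _≻′_} ≻′-trans deeper′ (ℕ.<-irrefl refl) σ₁-seg)
                      (tree-unique α-seg)
                      σ₁#α)
          (≺⇒Unique {S = _≺_} ℕ.<-trans up (ℕ.<-irrefl refl) W₁)
          λ { (z∈μ , z∈ω₁) → let a≤z , _ , b<z = ω₁-depth z∈ω₁ in off-climb z∈μ a≤z b<z })
        ω₂#rest
        where
        σ₁#α : Disjoint σ₁ (p ∷ α)
        σ₁#α (z∈σ₁ , here refl) =
          ℕ.<-irrefl refl (≺-last {S = _≻′_} ≻′-trans deeper′ σ₁-seg z∈σ₁)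
        σ₁#α (z∈σ₁ , there z∈α) = All.lookup α∉σ z∈α (∈-++⁺ˡ (σ₁⊆σ z∈σ₁))
        ω₂#rest : Disjoint ω₂ (μ ++ ω₁)
        ω₂#rest (z∈ω₂ , z∈) with ω₂-depth z∈ω₂ | ∈-++⁻ μ z∈
        ... | w≤z , b<z | inj₁ z∈μ  = off-climb z∈μ (ℕ.≤-trans a≤w w≤z) b<z
        ... | w≤z , _   | inj₂ z∈ω₁ = ℕ.<⇒≱ (proj₁ (proj₂ (ω₁-depth z∈ω₁))) w≤z

      k≤ω₂ : ∀ xs → k ≤ length (ω₂ ++ xs)
      k≤ω₂ xs = subst (k ≤_) (sym (length-++ ω₂)) (ℕ.m≤n⇒m≤n+o _ (ℕ.≤-reflexive (sym ∣ω₂∣)))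

      -- Cutting the cycle on `μ` leaves `ω₂` whole on one side and `ω₁` whole on the other, and
      -- each has length `k`.
      earFromμ : ∀ {q es} → q ∈ μ → Seg _⟶_ q es w → Unique es →
                 (∀ {z} → z ∈ es → z ∈ cycle → z ≡ q) → q ≢ w → SubdivisionB D k 1 k
      earFromμ {q} q∈μ e e-unique meets q≢w with split∈ μ-seg q∈μ
      ... | m₁ , m₂ , μ≡ , M₁ , M₂ =
        cycleWithEar D 2≤k q≢w (mapˢ proj₁ W₂ ++ˢ M₁) (M₂ ++ˢ mapˢ proj₁ W₁)
          (subst Unique cycle≡ cycle-unique) e e-unique
          (λ z∈e z∈ → meets z∈e (subst (_ ∈_) (sym cycle≡) z∈))
          (k≤ω₂ m₁)
          (inj₁ (subst (k ≤_) (sym (length-++ (q ∷ m₂)))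
                  (ℕ.m≤n⇒m≤o+n (length (q ∷ m₂)) (ℕ.≤-reflexive (sym ∣ω₁∣)))))
        where
        open ≡-Reasoning
        cycle≡ : cycle ≡ (ω₂ ++ m₁) ++ ((q ∷ m₂) ++ ω₁)
        cycle≡ = begin
          ω₂ ++ (μ ++ ω₁)                     ≡⟨ cong (λ xs → ω₂ ++ (xs ++ ω₁)) μ≡ ⟩
          ω₂ ++ ((m₁ ++ q ∷ m₂) ++ ω₁)        ≡⟨ cong (ω₂ ++_) (++-assoc m₁ (q ∷ m₂) ω₁) ⟩
          ω₂ ++ (m₁ ++ ((q ∷ m₂) ++ ω₁))      ≡⟨ ++-assoc ω₂ m₁ _ ⟨
          (ω₂ ++ m₁) ++ ((q ∷ m₂) ++ ω₁)      ∎

      -- The side from `q` to `w` is a piece of `ω₁` and may be short. The ear is a tree path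
      -- between congruent depths, hence long.
      earFromω₁ : ∀ {q es} → q ∈ ω₁ → Seg TreeArc q es w →
                  (∀ {z} → z ∈ es → z ∈ cycle → z ≡ q) → q ≢ w → SubdivisionB D k 1 k
      earFromω₁ {q} {es} q∈ω₁ e meets q≢w with split∈ W₁ q∈ω₁
      ... | o₁ , o₂ , ω₁≡ , O₁ , O₂ =
        cycleWithEar D 2≤k q≢w
          (mapˢ proj₁ W₂ ++ˢ (μ-seg ++ˢ mapˢ proj₁ O₁)) (mapˢ proj₁ O₂)
          (subst Unique cycle≡ cycle-unique) (mapˢ proj₁ e)
          (tree-unique e)
          (λ z∈e z∈ → meets z∈e (subst (_ ∈_) (sym cycle≡) z∈))
          (k≤ω₂ (μ ++ o₁)) (inj₂ long)
        where
        open ≡-Reasoning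
        cycle≡ : cycle ≡ (ω₂ ++ (μ ++ o₁)) ++ (q ∷ o₂)
        cycle≡ = begin
          ω₂ ++ (μ ++ ω₁)                     ≡⟨ cong (λ xs → ω₂ ++ (μ ++ xs)) ω₁≡ ⟩
          ω₂ ++ (μ ++ (o₁ ++ q ∷ o₂))         ≡⟨ cong (ω₂ ++_) (++-assoc μ o₁ (q ∷ o₂)) ⟨
          ω₂ ++ ((μ ++ o₁) ++ q ∷ o₂)         ≡⟨ ++-assoc ω₂ (μ ++ o₁) _ ⟨
          (ω₂ ++ (μ ++ o₁)) ++ (q ∷ o₂)       ∎
        long : k ≤ length es
        long = ℕ.+-cancelʳ-≤ (depth q) k (length es)
          (subst (k + depth q ≤_) (stem-length e)
            (subst (_≤ depth w) (ℕ.+-comm (depth q) k)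
              (mod-gap (proj₁ (proj₂ (ω₁-depth q∈ω₁)))
                (≺-last {S = _≈_} trans (λ c → proj₂ (proj₂ (proj₂ c))) W₁ q∈ω₁))))

      onlyHead : ∀ {q zs z} → All (_∉ cycle) zs → z ∈ q ∷ zs → z ∈ cycle → z ≡ q
      onlyHead _   (here z≡q)  _ = z≡q
      onlyHead off (there z∈) on = contradiction on (All.lookup off z∈)

      ear : SubdivisionB D k 1 k
      -- If the stem of `w` meets the cycle before `w`, its part after the last meeting is the ear.
      -- Such a `q` is shallower than `w`, so not on `ω₂`.
      ear with Any.any? (_∈? cycle) (branch w)
      ... | yes hit with splitLast (_∈? cycle) (stem w) hit
      ...   | q , _ , zs , _ , q∈C , off , _ , e with ∈-++⁻ ω₂ q∈C
      ...     | inj₁ q∈ω₂ = contradiction (proj₁ (ω₂-depth q∈ω₂)) (ℕ.<⇒≱ q<w)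
        where
        q<w : depth q < depth w
        q<w = tree-last e (here refl)
      ...     | inj₂ q∈rest with ∈-++⁻ μ q∈rest
      ...       | inj₁ q∈μ = earFromμ q∈μ (mapˢ proj₁ e)
        (tree-unique e) (onlyHead off)
        (λ { refl → ℕ.<-irrefl refl (tree-last e (here refl)) })
      ...       | inj₂ q∈ω₁ = earFromω₁ q∈ω₁ e (onlyHead off)
        (λ { refl → ℕ.<-irrefl refl (tree-last e (here refl)) })
      -- Otherwise the ear must come through the root, leaving the cycle for the last time on the
      -- in-tree path from `p`. Here `p ≢ r`, since the root is on the stem of `w`.
      ear | no miss with splitLast (_∈? cycle) σ₂-seg (lose (head∈ σ₂-seg p≢r) p∈C)
        where
        p∈C : p ∈ cycle
        p∈C = ∈-++⁺ʳ ω₂ (∈-++⁺ˡ (∈-++⁺ʳ σ₁ (here refl)))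
        p≢r : p ≢ r
        p≢r refl = miss (lose (head∈ (stem w) (above-b b<w)) p∈C)
      ... | q , ys , zs , σ₂≡ , q∈C , off , _ , e
        -- The in-tree path and the stem may intersect each other away from the cycle.
        with eraseLoops (mapˢ proj₁ e ++ˢ mapˢ proj₁ (stem w))
      ...   | es , e′ , es-unique , es⊆ = earFromμ q∈μ e′ es-unique meets q≢w
        where
        q≤b : depth′ q ≤ depth′ b
        q≤b = σ-depth (σ₂⊆σ (subst (q ∈_) (sym σ₂≡) (∈-++⁺ʳ ys (here refl))))
        q≢w : q ≢ w
        q≢w refl = ℕ.<⇒≱ b<w q≤b
        q∈μ : q ∈ μ
        q∈μ with ∈-++⁻ ω₂ q∈C
        ... | inj₁ q∈ω₂ = contradiction q≤b (ℕ.<⇒≱ (proj₂ (ω₂-depth q∈ω₂)))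
        ... | inj₂ q∈rest with ∈-++⁻ μ q∈rest
        ...   | inj₁ q∈μ  = q∈μ
        ...   | inj₂ q∈ω₁ = contradiction q≤b (ℕ.<⇒≱ (proj₂ (proj₂ (ω₁-depth q∈ω₁))))
        meets : ∀ {z} → z ∈ es → z ∈ cycle → z ≡ q
        meets z∈es z∈C with ∈-++⁻ (q ∷ zs) (es⊆ z∈es)
        ... | inj₁ z∈e = onlyHead off z∈e z∈C
        ... | inj₂ z∈τ = contradiction (lose z∈τ z∈C) miss

-- The bound on the chromatic number

-- A factor `k * suc k` for each tree colouring, and `k + k` for the arcs monochromatic under both.
colourBound : ℕ → ℕ
colourBound k = (k * suc k) * ((k * suc k) * (k + k))

module _ (D : Digraph) where
  open Digraph D using (_⟶_; arc; loopless)

  private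
    fromTrees : ∀ {r} → OutTree _⟶_ r → OutTree (flip _⟶_) r → ∀ k .{{_ : NonZero k}} → 2 ≤ k →
                SubdivisionB D k 1 k ⊎ Colourable D (colourBound k)
    fromTrees Out In k 2≤k
      with longChordOrColouring (λ u v → T? (arc u v)) Out k
         | longChordOrColouring (λ u v → T? (arc v u)) In k
    ... | inj₁ chord | _ = inj₁ (outChord⇒SubdivisionB D 2≤k Out chord)
    ... | inj₂ _ | inj₁ chord = inj₁ (inChord⇒SubdivisionB D 2≤k In chord)
    ... | inj₂ (c , increases) | inj₂ (c′ , decreases)
        with longWalkOrColouring
          (λ u v → T? (arc u v) ×-dec ((c u Fin.≟ c v) ×-dec (c′ u Fin.≟ c′ v))) (k + k)
    ...   | inj₁ (_ , _ , _ , walk , len) = inj₁ (longClimb⇒SubdivisionB D 2≤k Out In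
      -- The in-tree colouring speaks of reversed arcs, hence `sym same′`.
      (mapˢ (λ (a , same , same′) →
          a , proj₂ (increases same) a , proj₂ (decreases (sym same′)) a , proj₁ (increases same))
        walk) len)
    ...   | inj₂ (f , proper) = inj₂ (colour , λ
      { u v (inj₁ a) eq → distinct a eq ; u v (inj₂ a) eq → distinct a (sym eq) })
      where
      colour : Vertex D → Fin (colourBound k)
      colour v = combine (c v) (combine (c′ v) (f v))

      distinct : ∀ {u v} → u ⟶ v → colour u ≢ colour v
      distinct {u} {v} a eq =
        let same , rest = Fin.combine-injective (c u) _ (c v) _ eq
            same′ , fu≡fv = Fin.combine-injective (c′ u) (f u) (c′ v) (f v) rest
        in proper (a , same , same′) fu≡fv

  rootedSubdivisionOrColouring : Vertex D → ∀ k .{{_ : NonZero k}} → 2 ≤ k →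
    StronglyConnected D → SubdivisionB D k 1 k ⊎ Colourable D (colourBound k)
  rootedSubdivisionOrColouring r k 2≤k strong = fromTrees
    (outTree (λ u v → T? (arc u v)) (loopless _) r (λ v → Path.walk (strong r v)))
    (outTree (λ u v → T? (arc v u)) (loopless _) r
      (λ v → reverse (λ a → a) (Path.walk (strong v r))))
    k 2≤k

subdivisionOrColouring : (D : Digraph) → ∀ k .{{_ : NonZero k}} → 2 ≤ k →
  StronglyConnected D → SubdivisionB D k 1 k ⊎ Colourable D (colourBound k)
subdivisionOrColouring record { order = zero } k _ _ = inj₂ ((λ ()) , λ ())
subdivisionOrColouring D@(record { order = suc _ }) = rootedSubdivisionOrColouring D zero

SubdivisionB-weaken : ∀ {D k l} → k ≤ l → SubdivisionB D l 1 l → SubdivisionB D k 1 k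
SubdivisionB-weaken k≤l B = record
  { SubdivisionB B
  ; k₁≤P₁ = ℕ.≤-trans k≤l (SubdivisionB.k₁≤P₁ B)
  ; k₃≤P₃ = ℕ.≤-trans k≤l (SubdivisionB.k₃≤P₃ B)
  }

mainTheorem4 : ∀ (k : ℕ) → 1 ≤ k →
    ∃[ γ ] (∀ (D : Digraph) → StronglyConnected D →
    ∀ (χ : ℕ) → IsChromaticNumber D χ → γ < χ →
    SubdivisionB D k 1 k)
-- Passing to `suc k` secures `2 ≤ suc k` even when `k` is 1; the subdivision is weakened
-- afterwards.
mainTheorem4 k 1≤k = colourBound (suc k) , proof
  where
  proof : ∀ D → StronglyConnected D → ∀ χ → IsChromaticNumber D χ →
          colourBound (suc k) < χ → SubdivisionB D k 1 k
  proof D strong χ (_ , minimal) γ<χ with subdivisionOrColouring D (suc k) (s≤s 1≤k) strong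
  ... | inj₁ B   = SubdivisionB-weaken (ℕ.n≤1+n k) B
  ... | inj₂ col = contradiction (minimal _ col) (ℕ.<⇒≱ γ<χ)
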